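{- Let $(S,\to,\twoheadrightarrow,\hookrightarrow)$ be a two-acyclic factorization system and let $X\subseteq S$ be a closed set. Then $\operatorname{Del}(X,c)\lessdot X$ in the lattice of closed sets for all $c\in\operatorname{Cov}(X)$, and every element covered by $X$ is $\operatorname{Del}(X,c)$ for a unique $c\in\operatorname{Cov}(X)$.
   Context: For a binary relation $\to$ on a set $S$ and $X\subseteq S$, put $X^\perp=\{y\in S: x\not\to y\ \forall x\in X\}$ and ${}^\perp X=\{y\in S: y\not\to x\ \forall x\in X\}$. The closure of $X$ is $\overline X={}^\perp(X^\perp)$; $X$ is closed if $\overline X=X$. The closed sets, ordered by containment, form a complete lattice; $A\lessdot B$ means $B$ covers $A$. For a reflexive relation $\to$ on $S$, $\operatorname{Fact}(\to)=(\twoheadrightarrow,\hookrightarrow)$, where $x\twoheadrightarrow y$ iff for all $z$, $y\to z$ implies $x\to z$, and $x\hookrightarrow y$ iff for all $z$, $z\to x$ implies $z\to y$. For preorders $\twoheadrightarrow,\hookrightarrow$ on $S$, $\operatorname{Mult}(\twoheadrightarrow,\hookrightarrow)$ is the relation relating $x$ to $z$ iff there is $y\in S$ with $x\twoheadrightarrow y\hookrightarrow z$. A factorization system is a tuple $(S,\to,\twoheadrightarrow,\hookrightarrow)$ ($S$ possibly infinite) with $\to$ reflexive, $\operatorname{Fact}(\to)=(\twoheadrightarrow,\hookrightarrow)$ and $\operatorname{Mult}(\twoheadrightarrow,\hookrightarrow)=\to$. It is two-acyclic if $x\twoheadrightarrow y\twoheadrightarrow x$ implies $x=y$, $x\hookrightarrow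 y\hookrightarrow x$ implies $x=y$, and $x\twoheadrightarrow y\hookrightarrow x$ implies $x=y$. For $c\in X$, $\operatorname{Del}(X,c)=X\setminus\{x\in X: x\twoheadrightarrow c\}$. For a closed set $X$, $\operatorname{Cov}(X)$ is the set of elements $c\in X$ such that $\operatorname{Del}(X,c)$ is closed and $\overline{\operatorname{Del}(X,c)\cup\{c\}}=X$. -}

module Defs where

open import Level using (Level; suc)
open import Data.Product using (Σ; _×_; _,_; proj₁; ∃-syntax)
open import Relation.Binary.Core using (Rel; _⇔_)
open import Relation.Binary.Definitions using (Reflexive)
open import Relation.Binary.Bundles using (Poset)
open import Relation.Binary.PropositionalEquality.Core using (_≡_)
import Relation.Binary.Construct.On as On
import Relation.Binary.Properties.Poset as PosetProperties
open import Relation.Nullary.Negation using (¬_)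
open import Relation.Unary using (Pred; _∈_; _≐_; _∪_; _∖_; _∩_; ｛_｝)
open import Relation.Unary.Relation.Binary.Subset using (⊆-poset)

private
  variable
    a ℓ ℓ₁ ℓ₂ : Level

module _ (P : Poset a ℓ₁ ℓ₂) where
  open Poset P using (Carrier)
  open PosetProperties P using (_<_)

  CoveredBy : Rel Carrier _
  CoveredBy x y = x < y × ¬ (∃[ z ] (x < z × z < y))

-- S, the relations on it and its subsets share one universe level ℓ, so that
-- the closure of a subset is a subset at the same level.

module Closure {S : Set ℓ} (_⟶_ : Rel S ℓ) where

  infix 8 _^⊥ ⊥^_

  _^⊥ : Pred S ℓ → Pred S ℓ
  (X ^⊥) y = ∀ {x} → x ∈ X → ¬ (x ⟶ y)

  ⊥^_ : Pred S ℓ → Pred S ℓ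
  (⊥^ X) y = ∀ {x} → x ∈ X → ¬ (y ⟶ x)

  closure : Pred S ℓ → Pred S ℓ
  closure X = ⊥^ (X ^⊥)

  Closed : Pred S ℓ → Set ℓ
  Closed X = closure X ≐ X

  ClosedSet : Set (suc ℓ)
  ClosedSet = Σ (Pred S ℓ) Closed

  -- Equality of closed sets is extensional: mutual inclusion.
  closedSets : Poset (suc ℓ) ℓ ℓ
  closedSets = On.poset {B = ClosedSet} (⊆-poset S ℓ) proj₁

  infix 4 _⋖_

  _⋖_ : Rel ClosedSet (suc ℓ)
  _⋖_ = CoveredBy closedSets

module _ {S : Set ℓ} where

  -- The two components of Fact: Fact(→) = (FactEpi →, FactMono →).

  FactEpi : Rel S ℓ → Rel S ℓ
  FactEpi _⟶_ x y = ∀ z → y ⟶ z → x ⟶ z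

  FactMono : Rel S ℓ → Rel S ℓ
  FactMono _⟶_ x y = ∀ z → z ⟶ x → z ⟶ y

  Mult : Rel S ℓ → Rel S ℓ → Rel S ℓ
  Mult _↠_ _↪_ x z = ∃[ y ] (x ↠ y × y ↪ z)

-- The relations ↠ and ↪ are automatically preorders, by the Fact fields.

record FactorizationSystem (ℓ : Level) : Set (suc ℓ) where
  infix 4 _⟶_ _↠_ _↪_
  field
    S             : Set ℓ
    _⟶_ _↠_ _↪_   : Rel S ℓ
    ⟶-reflexive   : Reflexive _⟶_
    factEpi       : FactEpi _⟶_ ⇔ _↠_
    factMono      : FactMono _⟶_ ⇔ _↪_
    mult          : Mult _↠_ _↪_ ⇔ _⟶_

  open Closure _⟶_ public

  TwoAcyclic : Set ℓ
  TwoAcyclic = (∀ {x y} → x ↠ y → y ↠ x → x ≡ y)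
             × (∀ {x y} → x ↪ y → y ↪ x → x ≡ y)
             × (∀ {x y} → x ↠ y → y ↪ x → x ≡ y)

  Del : Pred S ℓ → S → Pred S ℓ
  Del X c = X ∖ (X ∩ (_↠ c))

  Cov : Pred S ℓ → Pred S ℓ
  Cov X c = c ∈ X × Closed (Del X c) × closure (Del X c ∪ ｛ c ｝) ≐ X

  delClosed : ∀ (X : Pred S ℓ) {c} → c ∈ Cov X → ClosedSet
  delClosed X {c} (_ , closed , _) = Del X c , closed

{-# OPTIONS --safe #-}

-- Suppose Y ⋖ X.  Every x ∈ X ∖ Y satisfies closure (Y ∪ {x}) = X, so x is
-- related to every element of X ∩ Y^⊥.  Factoring x ⟶ z, where x ∈ X and
-- z ∈ Y^⊥, gives x ↠ c ↪ z with c again in X ∩ Y^⊥.  The elements of X ∩ Y^⊥ are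
-- thus pairwise related, and two-acyclicity forces them to coincide; the single
-- element c satisfies x ↠ c for all x ∈ X ∖ Y, that is, Y = Del X c.

module Submission where

open import Defs
open import Axiom.DoubleNegationElimination using (DoubleNegationElimination; em⇒dne)
open import Axiom.ExcludedMiddle using (ExcludedMiddle)
open import Data.Product using (_×_; _,_; ∃!; ∃-syntax; proj₁; proj₂)
open import Data.Sum using (inj₁; inj₂)
open import Level using (Level)
open import Relation.Binary.Core using (Rel)
open import Relation.Binary.PropositionalEquality.Core using (_≡_; refl; sym; subst)
open import Relation.Unary using (Pred; _∈_; _∉_; _⊆_; _≐_; _∪_; _∩_; ｛_｝)

private
  variable
    ℓ : Level

module ClosureProperties {S : Set ℓ} (_⟶_ : Rel S ℓ) where
  open Closure _⟶_

  closure-extensive : (A : Pred S ℓ) → A ⊆ closure A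
  closure-extensive A a∈A y∈A⊥ = y∈A⊥ a∈A

  closure-mono : {A B : Pred S ℓ} → A ⊆ B → closure A ⊆ closure B
  closure-mono A⊆B x∈clA y∈B⊥ = x∈clA (λ a∈A → y∈B⊥ (A⊆B a∈A))

  closure-closed : (A : Pred S ℓ) → Closed (closure A)
  closure-closed A =
    (λ x∈clclA y∈A⊥ → x∈clclA (λ a∈clA → a∈clA y∈A⊥)) , closure-extensive (closure A)

  closure-least : {A B : Pred S ℓ} → Closed B → A ⊆ B → closure A ⊆ B
  closure-least (clB⊆B , _) A⊆B x∈clA = clB⊆B (closure-mono A⊆B x∈clA)

  closed-resp-≐ : {A B : Pred S ℓ} → A ≐ B → Closed A → Closed B
  closed-resp-≐ {B = B} (A⊆B , B⊆A) (clA⊆A , _) =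
    (λ x∈clB → A⊆B (clA⊆A (closure-mono B⊆A x∈clB))) , closure-extensive B

module FactorizationProperties (F : FactorizationSystem ℓ) where
  open FactorizationSystem F
  open ClosureProperties _⟶_

  ↠-refl : ∀ {x} → x ↠ x
  ↠-refl = proj₁ factEpi (λ _ x⟶z → x⟶z)

  ↠-trans : ∀ {x y z} → x ↠ y → y ↠ z → x ↠ z
  ↠-trans x↠y y↠z =
    proj₁ factEpi (λ w z⟶w → proj₂ factEpi x↠y w (proj₂ factEpi y↠z w z⟶w))

  -- Whatever `y` is related to, `x` is related to as well; so if `x` is related to nothing in
  -- `A ^⊥`, neither is `y`.
  closed-↠ : {A : Pred S ℓ} → Closed A → ∀ {x y} → x ↠ y → x ∈ A → y ∈ A
  closed-↠ (clA⊆A , A⊆clA) x↠y x∈A =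
    clA⊆A (λ {z} z∈A⊥ y⟶z → A⊆clA x∈A z∈A⊥ (proj₂ factEpi x↠y z y⟶z))

  ⊥-↪ : (A : Pred S ℓ) → ∀ {x y} → x ↪ y → y ∈ A ^⊥ → x ∈ A ^⊥
  ⊥-↪ A x↪y y∈A⊥ {w} w∈A w⟶x = y∈A⊥ w∈A (proj₂ factMono x↪y w w⟶x)

  ∉-Del : (A : Pred S ℓ) (c : S) → c ∉ Del A c
  ∉-Del A c (c∈A , ¬c↠c) = ¬c↠c (c∈A , ↠-refl)

  -- If a closed `Z` between the two sets contains some `x ↠ c`, then it contains `c`, hence the
  -- closure of `Del X c ∪ ｛ c ｝`, which is all of `X`. Otherwise `Z` lies inside `Del X c`.
  Del-⋖ : (X : ClosedSet) → ∀ {c} (c∈Cov : c ∈ Cov (proj₁ X)) →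
          delClosed (proj₁ X) c∈Cov ⋖ X
  Del-⋖ (X , _) {c} (c∈X , _ , _ , X⊆cl) =
    (proj₁ , λ (_ , X⊆Del) → ∉-Del X c (X⊆Del c∈X)) ,
    λ ((Z , Z-closed) , (Del⊆Z , Del≉Z) , (Z⊆X , Z≉X)) →
      Del≉Z (Del⊆Z , λ x∈Z → Z⊆X x∈Z , λ (_ , x↠c) →
        let c∈Z = closed-↠ Z-closed x↠c x∈Z in
        Z≉X (Z⊆X , λ y∈X → closure-least Z-closed
          (λ { (inj₁ d∈Del) → Del⊆Z d∈Del ; (inj₂ refl) → c∈Z }) (X⊆cl y∈X)))

  module _ (dne : DoubleNegationElimination ℓ) where

    -- Since `c` is missing from `Del A c`, it is missing from `Del A d`, which forces `c ↠ d`; the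
    -- converse is symmetric.
    Del-injective : {A : Pred S ℓ} → TwoAcyclic → ∀ {c d} → c ∈ A → d ∈ A →
                    Del A c ≐ Del A d → c ≡ d
    Del-injective {A} (↠-antisym , _) {c} {d} c∈A d∈A (Dc⊆Dd , Dd⊆Dc) = ↠-antisym
      (dne λ ¬c↠d → ∉-Del A c (Dd⊆Dc (c∈A , λ (_ , c↠d) → ¬c↠d c↠d)))
      (dne λ ¬d↠c → ∉-Del A d (Dc⊆Dd (d∈A , λ (_ , d↠c) → ¬d↠c d↠c)))

    -- The closure is a closed set inside `X` and strictly above `Y`, as it contains `x`. If it
    -- differed from `X`, it would lie strictly between them.
    ⋖⇒closure-∪ : (Y X : ClosedSet) → Y ⋖ X → ∀ {x} → x ∈ proj₁ X → x ∉ proj₁ Y →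
                  closure (proj₁ Y ∪ ｛ x ｝) ≐ proj₁ X
    ⋖⇒closure-∪ (Y , _) (X , X-closed) ((Y⊆X , _) , nothing-between) {x} x∈X x∉Y =
      dne λ cl≉X → nothing-between
        ( (closure (Y ∪ ｛ x ｝) , closure-closed (Y ∪ ｛ x ｝))
        , ( (λ y∈Y → closure-extensive (Y ∪ ｛ x ｝) (inj₁ y∈Y))
          , λ (_ , cl⊆Y) → x∉Y (cl⊆Y (closure-extensive (Y ∪ ｛ x ｝) (inj₂ refl))))
        , ( closure-least X-closed (λ { (inj₁ y∈Y) → Y⊆X y∈Y ; (inj₂ refl) → x∈X })
          , cl≉X))

    module Covering (Y X : ClosedSet) (Y⋖X : Y ⋖ X) where

      Gap : Pred S ℓ
      Gap = proj₁ X ∩ proj₁ Y ^⊥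

      gap-∉ : ∀ {c} → c ∈ Gap → c ∉ proj₁ Y
      gap-∉ (_ , c∈Y⊥) c∈Y = c∈Y⊥ c∈Y ⟶-reflexive

      -- The middle element stays in `X` because closed sets are stable forwards along `↠`, and in
      -- `Y ^⊥` because that set is stable backwards along `↪`.
      factor-through-gap : ∀ {x z} → x ∈ proj₁ X → z ∈ proj₁ Y ^⊥ → x ⟶ z →
                           ∃[ c ] (c ∈ Gap × x ↠ c × c ↪ z)
      factor-through-gap x∈X z∈Y⊥ x⟶z =
        let c , x↠c , c↪z = proj₂ mult x⟶z in
        c , (closed-↠ (proj₂ X) x↠c x∈X , ⊥-↪ (proj₁ Y) c↪z z∈Y⊥) , x↠c , c↪z

      ⟶-gap : ∀ {x z} → x ∈ proj₁ X → x ∉ proj₁ Y → z ∈ Gap → x ⟶ z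
      ⟶-gap x∈X x∉Y (z∈X , z∈Y⊥) = dne λ ¬x⟶z →
        -- If `x` were not related to `z`, then `z` would lie both in `(Y ∪ ｛ x ｝) ^⊥` and in the
        -- closure of `Y ∪ ｛ x ｝`, so it could not be related to itself.
        proj₂ (⋖⇒closure-∪ Y X Y⋖X x∈X x∉Y) z∈X
          (λ { (inj₁ y∈Y) → z∈Y⊥ y∈Y ; (inj₂ refl) → ¬x⟶z }) ⟶-reflexive

      -- Factor c ⟶ d as c ↠ e ↪ d and then e ⟶ c as e ↠ f ↪ c: acyclicity
      -- collapses c ↠ f ↪ c to f = c, and then c ↠ e ↠ c to e = c.
      gap-↪ : TwoAcyclic → ∀ {c d} → c ∈ Gap → d ∈ Gap → c ↪ d
      gap-↪ (↠-antisym , _ , ↠↪-antisym) {c} {d} c∈G d∈G =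
        let e , e∈G , c↠e , e↪d =
              factor-through-gap (proj₁ c∈G) (proj₂ d∈G) (⟶-gap (proj₁ c∈G) (gap-∉ c∈G) d∈G)
            f , _ , e↠f , f↪c =
              factor-through-gap (proj₁ e∈G) (proj₂ c∈G) (⟶-gap (proj₁ e∈G) (gap-∉ e∈G) c∈G)
            c≡f = ↠↪-antisym (↠-trans c↠e e↠f) f↪c
            c≡e = ↠-antisym c↠e (subst (e ↠_) (sym c≡f) e↠f)
        in subst (_↪ d) (sym c≡e) e↪d

      gap-unique : TwoAcyclic → ∀ {c d} → c ∈ Gap → d ∈ Gap → c ≡ d
      gap-unique acyclic@(_ , ↪-antisym , _) c∈G d∈G =
        ↪-antisym (gap-↪ acyclic c∈G d∈G) (gap-↪ acyclic d∈G c∈G)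

      -- With an empty gap no arrow from `X` to `Y ^⊥` could factor, so there would be none. Then
      -- `X` would lie in the closure of `Y`, which is `Y`, against strictness.
      gap-inhabited : ∃[ c ] c ∈ Gap
      gap-inhabited = dne λ empty →
        let (Y⊆X , Y≉X) , _ = Y⋖X in
        Y≉X (Y⊆X , λ x∈X → proj₁ (proj₂ Y) (λ z∈Y⊥ x⟶z →
          let c , c∈G , _ = factor-through-gap x∈X z∈Y⊥ x⟶z in empty (c , c∈G)))

      gap-Del : TwoAcyclic → ∀ {c} → c ∈ Gap → proj₁ Y ≐ Del (proj₁ X) c
      gap-Del acyclic {c} c∈G =
        (λ y∈Y → proj₁ (proj₁ Y⋖X) y∈Y ,
          λ (_ , y↠c) → gap-∉ c∈G (closed-↠ (proj₂ Y) y↠c y∈Y)) ,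
        -- An `x` outside `Y` is related to `c`. The middle element of a factorization of this arrow
        -- is in the gap, so it is `c` itself, and `x ↠ c`.
        λ {x} (x∈X , ¬x↠c) → dne λ x∉Y →
          let d , d∈G , x↠d , _ =
                factor-through-gap x∈X (proj₂ c∈G) (⟶-gap x∈X x∉Y c∈G)
          in ¬x↠c (x∈X , subst (x ↠_) (gap-unique acyclic d∈G c∈G) x↠d)

      gap-Cov : TwoAcyclic → ∀ {c} → c ∈ Gap → c ∈ Cov (proj₁ X)
      gap-Cov acyclic {c} c∈G@(c∈X , _) =
        let Y⊆Del , Del⊆Y = gap-Del acyclic c∈G
            cl⊆X , X⊆cl   = ⋖⇒closure-∪ Y X Y⋖X c∈X (gap-∉ c∈G)
        in c∈X , closed-resp-≐ (Y⊆Del , Del⊆Y) (proj₂ Y) ,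
           (λ x∈cl → cl⊆X (closure-mono
             (λ { (inj₁ x∈Del) → inj₁ (Del⊆Y x∈Del) ; (inj₂ eq) → inj₂ eq }) x∈cl)) ,
           (λ x∈X → closure-mono
             (λ { (inj₁ x∈Y) → inj₁ (Y⊆Del x∈Y) ; (inj₂ eq) → inj₂ eq }) (X⊆cl x∈X))

theorem5p1 : ∀ {ℓ} → ExcludedMiddle ℓ →
    (F : FactorizationSystem ℓ) →
    let open FactorizationSystem F in
    TwoAcyclic →
    (X : ClosedSet) →
    (∀ {c} (c∈Cov : c ∈ Cov (proj₁ X)) → delClosed (proj₁ X) c∈Cov ⋖ X)
    × (∀ (Y : ClosedSet) → Y ⋖ X →
    ∃! _≡_ (λ c → c ∈ Cov (proj₁ X) × proj₁ Y ≐ Del (proj₁ X) c))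
theorem5p1 em F acyclic X = Del-⋖ X , λ Y Y⋖X →
  let open Covering dne Y X Y⋖X
      c , c∈G         = gap-inhabited
      Y⊆Delc , Delc⊆Y = gap-Del acyclic c∈G
  in c , (gap-Cov acyclic c∈G , (Y⊆Delc , Delc⊆Y)) ,
     -- Both deletions equal `Y`, so they equal each other and `Del-injective` applies.
     λ ((d∈X , _) , Y⊆Deld , Deld⊆Y) →
       Del-injective dne acyclic (proj₁ c∈G) d∈X
         ((λ x∈Delc → Y⊆Deld (Delc⊆Y x∈Delc)) , (λ x∈Deld → Y⊆Delc (Deld⊆Y x∈Deld)))
  where
  open FactorizationProperties F
  dne = em⇒dne em
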